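{- Let $D=\mathbb{Z}[\omega]$ with $\omega=\frac{ -1+i\sqrt{3}}{2}$, and let $\pi\in D$ be a prime with $N\pi\neq 3$. Then $$\chi_\pi(\omega)=\omega^{\frac{N\pi-1}{3}}=\begin{cases}1 & \text{if } N\pi\equiv 1\pmod 9,\\ \omega & \text{if } N\pi\equiv 4\pmod 9,\\ \omega^2 & \text{if } N\pi\equiv 7\pmod 9.\end{cases}$$
   Context: For $\alpha=a+b\omega\in D$ with $a,b\in\mathbb{Z}$, the norm is $N\alpha=\alpha\overline{\alpha}=a^2-ab+b^2$. For a prime $\pi\in D$ with $N\pi\ne 3$, the cubic residue character $\chi_\pi$ on $D$ is defined by: $\chi_\pi(\alpha)=0$ if $\pi\mid\alpha$; otherwise $\chi_\pi(\alpha)$ is the unique element of $\{1,\omega,\omega^2\}$ with $\alpha^{(N\pi-1)/3}\equiv\chi_\pi(\alpha)\pmod{\pi}$. -}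

module Defs where

open import Algebra.Bundles using (CommutativeRing; Semiring)
import Algebra.Definitions.RawMagma as RawMagmaDefs
import Algebra.Definitions.RawSemiring as RawSemiringDefs
open import Algebra.Structures using (IsCommutativeRing)
open import Data.Empty using (⊥-elim)
open import Data.Integer as ℤ using (ℤ; +_; 0ℤ; 1ℤ)
import Data.Integer.Properties as ℤ
import Data.Integer.Divisibility.Signed as ℤ∣
open import Data.Integer.Tactic.RingSolver using (solve-∀)
open import Data.List.Base using (List; []; _∷_)
open import Data.List.Membership.Propositional using (_∈_)
open import Data.List.Relation.Unary.Any using (here; there)
open import Data.Nat as ℕ using (ℕ)
import Data.Nat.Properties as ℕ
open import Data.Product.Base using (_×_; _,_)
open import Data.Sum.Base using (inj₁; inj₂)
open import Level using (0ℓ)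
open import Relation.Binary.PropositionalEquality
  using (_≡_; _≢_; refl; sym; trans; cong; cong₂; isEquivalence; module ≡-Reasoning)
open import Relation.Nullary using (Dec; yes; no)
open import Relation.Nullary.Decidable using (map′; _×-dec_)

-- D = ℤ[ω] in its ℤ-basis {1, ω}: ⟨ a , b ⟩ is a + bω.  The product is
-- forced by ω² = -1 - ω, the equation satisfied by ω = (-1 + i√3)/2.

record D : Set where
  constructor ⟨_,_⟩
  field
    const : ℤ
    ωcoef : ℤ

infixl 6 _+_ _-_
infixl 7 _*_
infix  8 -_

_+_ _*_ : D → D → D
⟨ a , b ⟩ + ⟨ c , d ⟩ = ⟨ a ℤ.+ c , b ℤ.+ d ⟩
⟨ a , b ⟩ * ⟨ c , d ⟩ = ⟨ a ℤ.* c ℤ.- b ℤ.* d , a ℤ.* d ℤ.+ b ℤ.* c ℤ.- b ℤ.* d ⟩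

-_ : D → D
- ⟨ a , b ⟩ = ⟨ ℤ.- a , ℤ.- b ⟩

_-_ : D → D → D
x - y = x + (- y)

fromℤ : ℤ → D
fromℤ n = ⟨ n , 0ℤ ⟩

0# 1# ω : D
0# = fromℤ 0ℤ
1# = fromℤ 1ℤ
ω  = ⟨ 0ℤ , 1ℤ ⟩

+-*-isCommutativeRing : IsCommutativeRing _≡_ _+_ _*_ (-_) 0# 1#
+-*-isCommutativeRing = record
  { isRing = record
    { +-isAbelianGroup = record
      { isGroup = record
        { isMonoid = record
          { isSemigroup = record
            { isMagma = record { isEquivalence = isEquivalence ; ∙-cong = cong₂ _+_ }
            ; assoc   = λ x y z → cong₂ ⟨_,_⟩ (ℤ.+-assoc (D.const x) _ _) (ℤ.+-assoc (D.ωcoef x) _ _)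
            }
          ; identity = (λ x → cong₂ ⟨_,_⟩ (ℤ.+-identityˡ _) (ℤ.+-identityˡ _))
                     , (λ x → cong₂ ⟨_,_⟩ (ℤ.+-identityʳ _) (ℤ.+-identityʳ _))
          }
        ; inverse = (λ x → cong₂ ⟨_,_⟩ (ℤ.+-inverseˡ (D.const x)) (ℤ.+-inverseˡ (D.ωcoef x)))
                  , (λ x → cong₂ ⟨_,_⟩ (ℤ.+-inverseʳ (D.const x)) (ℤ.+-inverseʳ (D.ωcoef x)))
        ; ⁻¹-cong = cong (-_)
        }
      ; comm = λ x y → cong₂ ⟨_,_⟩ (ℤ.+-comm (D.const x) _) (ℤ.+-comm (D.ωcoef x) _)
      }
    ; *-cong     = cong₂ _*_
    ; *-assoc    = λ { ⟨ a , b ⟩ ⟨ c , d ⟩ ⟨ e , f ⟩ →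
                       cong₂ ⟨_,_⟩ (assoc₁ a b c d e f) (assoc₂ a b c d e f) }
    ; *-identity = (λ { ⟨ a , b ⟩ → cong₂ ⟨_,_⟩ (idˡ₁ a b) (idˡ₂ a b) })
                 , (λ { ⟨ a , b ⟩ → cong₂ ⟨_,_⟩ (idʳ₁ a b) (idʳ₂ a b) })
    ; distrib    = (λ { ⟨ a , b ⟩ ⟨ c , d ⟩ ⟨ e , f ⟩ →
                        cong₂ ⟨_,_⟩ (distˡ₁ a b c d e f) (distˡ₂ a b c d e f) })
                 , (λ { ⟨ a , b ⟩ ⟨ c , d ⟩ ⟨ e , f ⟩ →
                        cong₂ ⟨_,_⟩ (distʳ₁ a b c d e f) (distʳ₂ a b c d e f) })
    }
  ; *-comm = λ { ⟨ a , b ⟩ ⟨ c , d ⟩ → cong₂ ⟨_,_⟩ (comm₁ a b c d) (comm₂ a b c d) }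
  }
  where
  assoc₁ : ∀ a b c d e f →
    (a ℤ.* c ℤ.- b ℤ.* d) ℤ.* e ℤ.- (a ℤ.* d ℤ.+ b ℤ.* c ℤ.- b ℤ.* d) ℤ.* f
      ≡ a ℤ.* (c ℤ.* e ℤ.- d ℤ.* f) ℤ.- b ℤ.* (c ℤ.* f ℤ.+ d ℤ.* e ℤ.- d ℤ.* f)
  assoc₁ = solve-∀

  assoc₂ : ∀ a b c d e f →
    (a ℤ.* c ℤ.- b ℤ.* d) ℤ.* f ℤ.+ (a ℤ.* d ℤ.+ b ℤ.* c ℤ.- b ℤ.* d) ℤ.* e ℤ.- (a ℤ.* d ℤ.+ b ℤ.* c ℤ.- b ℤ.* d) ℤ.* f
      ≡ a ℤ.* (c ℤ.* f ℤ.+ d ℤ.* e ℤ.- d ℤ.* f) ℤ.+ b ℤ.* (c ℤ.* e ℤ.- d ℤ.* f) ℤ.- b ℤ.* (c ℤ.* f ℤ.+ d ℤ.* e ℤ.- d ℤ.* f)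
  assoc₂ = solve-∀

  idˡ₁ : ∀ a b → 1ℤ ℤ.* a ℤ.- 0ℤ ℤ.* b ≡ a
  idˡ₁ = solve-∀

  idˡ₂ : ∀ a b → 1ℤ ℤ.* b ℤ.+ 0ℤ ℤ.* a ℤ.- 0ℤ ℤ.* b ≡ b
  idˡ₂ = solve-∀

  idʳ₁ : ∀ a b → a ℤ.* 1ℤ ℤ.- b ℤ.* 0ℤ ≡ a
  idʳ₁ = solve-∀

  idʳ₂ : ∀ a b → a ℤ.* 0ℤ ℤ.+ b ℤ.* 1ℤ ℤ.- b ℤ.* 0ℤ ≡ b
  idʳ₂ = solve-∀

  distˡ₁ : ∀ a b c d e f →
    a ℤ.* (c ℤ.+ e) ℤ.- b ℤ.* (d ℤ.+ f) ≡ (a ℤ.* c ℤ.- b ℤ.* d) ℤ.+ (a ℤ.* e ℤ.- b ℤ.* f)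
  distˡ₁ = solve-∀

  distˡ₂ : ∀ a b c d e f →
    a ℤ.* (d ℤ.+ f) ℤ.+ b ℤ.* (c ℤ.+ e) ℤ.- b ℤ.* (d ℤ.+ f)
      ≡ (a ℤ.* d ℤ.+ b ℤ.* c ℤ.- b ℤ.* d) ℤ.+ (a ℤ.* f ℤ.+ b ℤ.* e ℤ.- b ℤ.* f)
  distˡ₂ = solve-∀

  distʳ₁ : ∀ a b c d e f →
    (c ℤ.+ e) ℤ.* a ℤ.- (d ℤ.+ f) ℤ.* b ≡ (c ℤ.* a ℤ.- d ℤ.* b) ℤ.+ (e ℤ.* a ℤ.- f ℤ.* b)
  distʳ₁ = solve-∀

  distʳ₂ : ∀ a b c d e f →
    (c ℤ.+ e) ℤ.* b ℤ.+ (d ℤ.+ f) ℤ.* a ℤ.- (d ℤ.+ f) ℤ.* b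
      ≡ (c ℤ.* b ℤ.+ d ℤ.* a ℤ.- d ℤ.* b) ℤ.+ (e ℤ.* b ℤ.+ f ℤ.* a ℤ.- f ℤ.* b)
  distʳ₂ = solve-∀

  comm₁ : ∀ a b c d → a ℤ.* c ℤ.- b ℤ.* d ≡ c ℤ.* a ℤ.- d ℤ.* b
  comm₁ = solve-∀

  comm₂ : ∀ a b c d → a ℤ.* d ℤ.+ b ℤ.* c ℤ.- b ℤ.* d ≡ c ℤ.* b ℤ.+ d ℤ.* a ℤ.- d ℤ.* b
  comm₂ = solve-∀

+-*-commutativeRing : CommutativeRing 0ℓ 0ℓ
+-*-commutativeRing = record { isCommutativeRing = +-*-isCommutativeRing }

private
  module R = CommutativeRing +-*-commutativeRing
  module Rₛ = Semiring R.semiring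

open RawSemiringDefs Rₛ.rawSemiring public
  using (_^_; _∣_; _∤_; Prime)
open RawMagmaDefs R.*-rawMagma using (_,_)

ω²+ω+1≡0 : ω ^ 2 + ω + 1# ≡ 0#
ω²+ω+1≡0 = refl

-- Complex conjugation: ω̄ = ω² = -1 - ω.

conj : D → D
conj ⟨ a , b ⟩ = ⟨ a ℤ.- b , ℤ.- b ⟩

N : D → ℤ
N ⟨ a , b ⟩ = a ℤ.* a ℤ.- a ℤ.* b ℤ.+ b ℤ.* b

α*conj≡N : ∀ α → α * conj α ≡ fromℤ (N α)
α*conj≡N ⟨ a , b ⟩ = cong₂ ⟨_,_⟩ (eq₁ a b) (eq₂ a b)
  where
  eq₁ : ∀ a b → a ℤ.* (a ℤ.- b) ℤ.- b ℤ.* (ℤ.- b) ≡ a ℤ.* a ℤ.- a ℤ.* b ℤ.+ b ℤ.* b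
  eq₁ = solve-∀
  eq₂ : ∀ a b → a ℤ.* (ℤ.- b) ℤ.+ b ℤ.* (a ℤ.- b) ℤ.- b ℤ.* (ℤ.- b) ≡ 0ℤ
  eq₂ = solve-∀

infix 4 _≡_[mod_]

_≡_[mod_] : D → D → D → Set
α ≡ β [mod π ] = π ∣ α - β

square : ∀ i → i ℤ.* i ≡ + (ℤ.∣ i ∣ ℕ.* ℤ.∣ i ∣)
square (+ n)      = sym (ℤ.pos-* n n)
square ℤ.-[1+ n ] = refl

square≡0 : ∀ i → ℤ.∣ i ∣ ℕ.* ℤ.∣ i ∣ ≡ 0 → i ≡ 0ℤ
square≡0 i eq with ℕ.m*n≡0⇒m≡0∨n≡0 ℤ.∣ i ∣ eq
... | inj₁ p = ℤ.∣i∣≡0⇒i≡0 p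
... | inj₂ p = ℤ.∣i∣≡0⇒i≡0 p

N≡0⇒≡0 : ∀ α → N α ≡ 0ℤ → α ≡ 0#
N≡0⇒≡0 ⟨ a , b ⟩ N≡0 = cong₂ ⟨_,_⟩ a≡0 b≡0
  where
  4N : ∀ a b → (+ 2 ℤ.* a ℤ.- b) ℤ.* (+ 2 ℤ.* a ℤ.- b) ℤ.+ + 3 ℤ.* (b ℤ.* b)
                 ≡ + 4 ℤ.* (a ℤ.* a ℤ.- a ℤ.* b ℤ.+ b ℤ.* b)
  4N = solve-∀

  c : ℤ
  c = + 2 ℤ.* a ℤ.- b

  sum≡0 : ℤ.∣ c ∣ ℕ.* ℤ.∣ c ∣ ℕ.+ 3 ℕ.* (ℤ.∣ b ∣ ℕ.* ℤ.∣ b ∣) ≡ 0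
  sum≡0 = ℤ.+-injective (begin
    + (ℤ.∣ c ∣ ℕ.* ℤ.∣ c ∣) ℤ.+ + (3 ℕ.* (ℤ.∣ b ∣ ℕ.* ℤ.∣ b ∣))
      ≡⟨ cong₂ ℤ._+_ (sym (square c)) (trans (ℤ.pos-* 3 (ℤ.∣ b ∣ ℕ.* ℤ.∣ b ∣)) (cong (+ 3 ℤ.*_) (sym (square b)))) ⟩
    c ℤ.* c ℤ.+ + 3 ℤ.* (b ℤ.* b)
      ≡⟨ 4N a b ⟩
    + 4 ℤ.* N ⟨ a , b ⟩
      ≡⟨ cong (+ 4 ℤ.*_) N≡0 ⟩
    0ℤ ∎)
    where open ≡-Reasoning

  b≡0 : b ≡ 0ℤ
  b≡0 = square≡0 b (ℕ.*-cancelˡ-≡ _ 0 3 (ℕ.m+n≡0⇒n≡0 (ℤ.∣ c ∣ ℕ.* ℤ.∣ c ∣) sum≡0))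

  a*a : ∀ a → a ℤ.* a ≡ a ℤ.* a ℤ.- a ℤ.* 0ℤ ℤ.+ 0ℤ ℤ.* 0ℤ
  a*a = solve-∀

  a≡0 : a ≡ 0ℤ
  a≡0 = square≡0 a (ℤ.+-injective (trans (sym (square a)) (trans (a*a a)
          (trans (cong (λ z → a ℤ.* a ℤ.- a ℤ.* z ℤ.+ z ℤ.* z) (sym b≡0)) N≡0))))

scale : ∀ n α → fromℤ n * α ≡ ⟨ D.const α ℤ.* n , D.ωcoef α ℤ.* n ⟩
scale n ⟨ a , b ⟩ = cong₂ ⟨_,_⟩ (eq₁ n a b) (eq₂ n a b)
  where
  eq₁ : ∀ n a b → n ℤ.* a ℤ.- 0ℤ ℤ.* b ≡ a ℤ.* n
  eq₁ = solve-∀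
  eq₂ : ∀ n a b → n ℤ.* b ℤ.+ 0ℤ ℤ.* a ℤ.- 0ℤ ℤ.* b ≡ b ℤ.* n
  eq₂ = solve-∀

scale-injective : ∀ n → n ≢ 0ℤ → ∀ {α β} → fromℤ n * α ≡ fromℤ n * β → α ≡ β
scale-injective n n≢0 {α} {β} eq =
  cong₂ ⟨_,_⟩ (ℤ.*-cancelʳ-≡ _ _ n (cong D.const eq′)) (ℤ.*-cancelʳ-≡ _ _ n (cong D.ωcoef eq′))
  where
  instance _ = ℤ.≢-nonZero n≢0
  eq′ = trans (sym (scale n α)) (trans eq (scale n β))

-- For π ≠ 0, π ∣ α iff Nπ divides both coefficients of α * conj π.

infix 4 _∣?_

_∣?_ : ∀ π α → Dec (π ∣ α)
π ∣? α with N π ℤ.≟ 0ℤ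
... | yes N≡0 = map′ to from ((D.const α ℤ.≟ 0ℤ) ×-dec (D.ωcoef α ℤ.≟ 0ℤ))
  where
  π≡0 = N≡0⇒≡0 π N≡0
  to : D.const α ≡ 0ℤ × D.ωcoef α ≡ 0ℤ → π ∣ α
  to (p , q) = 0# , trans (R.zeroˡ π) (sym (cong₂ ⟨_,_⟩ p q))
  from : π ∣ α → D.const α ≡ 0ℤ × D.ωcoef α ≡ 0ℤ
  from (q , eq) = cong D.const α≡0 , cong D.ωcoef α≡0
    where α≡0 = trans (sym eq) (trans (cong (q *_) π≡0) (R.zeroʳ q))
... | no N≢0 = map′ to from ((N π ℤ∣.∣? D.const (α * conj π)) ×-dec (N π ℤ∣.∣? D.ωcoef (α * conj π)))
  where
  open ≡-Reasoning
  to : (N π ℤ∣.∣ D.const (α * conj π)) × (N π ℤ∣.∣ D.ωcoef (α * conj π)) → π ∣ α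
  to (ℤ∣.divides s es , ℤ∣.divides t et) = q , scale-injective (N π) N≢0 (begin
    fromℤ (N π) * (q * π)  ≡⟨ R.*-assoc (fromℤ (N π)) q π ⟨
    fromℤ (N π) * q * π    ≡⟨ cong (_* π) (trans (scale (N π) q) (sym (cong₂ ⟨_,_⟩ es et))) ⟩
    α * conj π * π         ≡⟨ R.*-assoc α (conj π) π ⟩
    α * (conj π * π)       ≡⟨ cong (α *_) (trans (R.*-comm (conj π) π) (α*conj≡N π)) ⟩
    α * fromℤ (N π)        ≡⟨ R.*-comm α (fromℤ (N π)) ⟩
    fromℤ (N π) * α        ∎)
    where q = ⟨ s , t ⟩
  from : π ∣ α → (N π ℤ∣.∣ D.const (α * conj π)) × (N π ℤ∣.∣ D.ωcoef (α * conj π))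
  from (q , refl) = ℤ∣.divides (D.const q) (cong D.const eq)
                  , ℤ∣.divides (D.ωcoef q) (cong D.ωcoef eq)
    where
    eq : q * π * conj π ≡ ⟨ D.const q ℤ.* N π , D.ωcoef q ℤ.* N π ⟩
    eq = begin
      q * π * conj π    ≡⟨ R.*-assoc q π (conj π) ⟩
      q * (π * conj π)  ≡⟨ cong (q *_) (α*conj≡N π) ⟩
      q * fromℤ (N π)   ≡⟨ R.*-comm q (fromℤ (N π)) ⟩
      fromℤ (N π) * q   ≡⟨ scale (N π) q ⟩
      ⟨ D.const q ℤ.* N π , D.ωcoef q ℤ.* N π ⟩ ∎

-- (Nπ - 1)/3.  The division is exact and Nπ ≥ 1 whenever π is prime with Nπ ≠ 3.

cubicExponent : D → ℕ
cubicExponent π = ℤ.∣ N π ℤ.- 1ℤ ∣ ℕ./ 3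

cubeRootsOfUnity : List D
cubeRootsOfUnity = 1# ∷ ω ∷ ω ^ 2 ∷ []

record IsCubicCharacterValue (π α c : D) : Set where
  field
    isRoot    : c ∈ cubeRootsOfUnity
    congruent : α ^ cubicExponent π ≡ c [mod π ]
    unique    : ∀ {c′} → c′ ∈ cubeRootsOfUnity → α ^ cubicExponent π ≡ c′ [mod π ] → c′ ≡ c

firstCongruent : (π β : D) → List D → D
firstCongruent π β []       = 0#
firstCongruent π β (c ∷ cs) with π ∣? (β - c)
... | yes _ = c
... | no  _ = firstCongruent π β cs

-- The cubic residue character χ π α, as a total function.  For π prime with
-- Nπ ≠ 3 and π ∤ α exactly one root of unity is congruent to α ^ cubicExponent π,
-- so there the order of the search and its default value 0# play no role.

χ : D → D → D
χ π α with π ∣? α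
... | yes _ = 0#
... | no  _ = firstCongruent π (α ^ cubicExponent π) cubeRootsOfUnity

χ-zero : ∀ {π α} → π ∣ α → χ π α ≡ 0#
χ-zero {π} {α} π∣α with π ∣? α
... | yes _   = refl
... | no  π∤α = ⊥-elim (π∤α π∣α)

χ-unique : ∀ {π α c} → π ∤ α → IsCubicCharacterValue π α c → χ π α ≡ c
χ-unique {π} {α} {c} π∤α res with π ∣? α
... | yes π∣α = ⊥-elim (π∤α π∣α)
... | no  _   = search cubeRootsOfUnity (λ z → z) isRoot
  where
  open IsCubicCharacterValue res
  search : ∀ cs → (∀ {x} → x ∈ cs → x ∈ cubeRootsOfUnity) → c ∈ cs →
           firstCongruent π (α ^ cubicExponent π) cs ≡ c
  search (x ∷ xs) sub c∈ with π ∣? (α ^ cubicExponent π - x)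
  ... | yes p = unique (sub (here refl)) p
  search (x ∷ xs) sub (here refl) | no ¬p = ⊥-elim (¬p congruent)
  search (x ∷ xs) sub (there c∈)  | no ¬p = search xs (λ z → sub (there z)) c∈

{-# OPTIONS --safe #-}

-- Everything rests on N (1 - ω) = 3: a prime π with Nπ ≠ 3 divides no element of
-- norm 3.  Since the differences of distinct cube roots of unity have norm 3, the
-- character value is unique.  Moreover 1 - ω ∤ π, that is 3 ∤ a + b for π = a + bω,
-- so Nπ = (a + b)² - 3ab = 1 + 3k, and ω ^ k depends only on k mod 3, i.e. on
-- Nπ mod 9.

module Submission where

open import Defs
open import Algebra.Bundles using (CommutativeRing)
import Algebra.Definitions.RawMagma as RawMagmaDefs
import Algebra.Properties.Semiring.Exp as Exp
open import Data.Integer as ℤ using (ℤ; +_; 0ℤ; 1ℤ; _%ℕ_)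
import Data.Integer.DivMod as ℤ
import Data.Integer.Properties as ℤ
open import Data.Integer.Tactic.RingSolver using (solve-∀)
open import Data.List.Membership.Propositional using (_∈_)
open import Data.List.Relation.Unary.Any using (here; there)
open import Data.Nat as ℕ using (ℕ; zero; suc; s≤s)
import Data.Nat.Divisibility as ℕ
import Data.Nat.DivMod as ℕ
import Data.Nat.Properties as ℕ
open import Data.Nat.Primality using (irreducible?)
open import Data.Product.Base using (_×_; _,_; ∃; map₂)
open import Data.Sum.Base as Sum using (_⊎_; inj₁; inj₂)
open import Relation.Binary.PropositionalEquality
  using (_≡_; _≢_; refl; sym; trans; cong; cong₂; subst; module ≡-Reasoning)
open import Relation.Nullary using (contradiction)
open import Relation.Nullary.Decidable using (from-yes)

open CommutativeRing +-*-commutativeRing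
  using (semiring; *-rawMagma; *-comm; *-identityˡ; zeroˡ; -‿inverseʳ)
open RawMagmaDefs *-rawMagma using (_,_)
open Exp semiring using (^-homo-*)

N-* : ∀ α β → N (α * β) ≡ N α ℤ.* N β
N-* ⟨ a , b ⟩ ⟨ c , d ⟩ = eq a b c d
  where
  eq : ∀ a b c d →
    (a ℤ.* c ℤ.- b ℤ.* d) ℤ.* (a ℤ.* c ℤ.- b ℤ.* d)
      ℤ.- (a ℤ.* c ℤ.- b ℤ.* d) ℤ.* (a ℤ.* d ℤ.+ b ℤ.* c ℤ.- b ℤ.* d)
      ℤ.+ (a ℤ.* d ℤ.+ b ℤ.* c ℤ.- b ℤ.* d) ℤ.* (a ℤ.* d ℤ.+ b ℤ.* c ℤ.- b ℤ.* d)
    ≡ (a ℤ.* a ℤ.- a ℤ.* b ℤ.+ b ℤ.* b) ℤ.* (c ℤ.* c ℤ.- c ℤ.* d ℤ.+ d ℤ.* d)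
  eq = solve-∀

-- Completing the square gives `4N = (2a - b)² + 3b²`, a sum of squares. Divisibility of norms can
-- then be studied in `ℕ`.
N-nonNegative : ∀ α → N α ≡ + ℤ.∣ N α ∣
N-nonNegative ⟨ a , b ⟩ = nonNeg (N ⟨ a , b ⟩) (begin
  + 4 ℤ.* N ⟨ a , b ⟩
    ≡⟨ 4N a b ⟩
  c ℤ.* c ℤ.+ b ℤ.* b ℤ.+ b ℤ.* b ℤ.+ b ℤ.* b
    ≡⟨ cong₂ (λ x y → x ℤ.+ y ℤ.+ y ℤ.+ y) (square c) (square b) ⟩
  + (ℤ.∣ c ∣ ℕ.* ℤ.∣ c ∣ ℕ.+ B ℕ.+ B ℕ.+ B) ∎)
  where
  open ≡-Reasoning

  c : ℤ
  c = + 2 ℤ.* a ℤ.- b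

  B : ℕ
  B = ℤ.∣ b ∣ ℕ.* ℤ.∣ b ∣

  4N : ∀ a b → + 4 ℤ.* (a ℤ.* a ℤ.- a ℤ.* b ℤ.+ b ℤ.* b)
    ≡ (+ 2 ℤ.* a ℤ.- b) ℤ.* (+ 2 ℤ.* a ℤ.- b) ℤ.+ b ℤ.* b ℤ.+ b ℤ.* b ℤ.+ b ℤ.* b
  4N = solve-∀

  nonNeg : ∀ i {m} → + 4 ℤ.* i ≡ + m → i ≡ + ℤ.∣ i ∣
  -- For negative `i` the product `4i` reduces to a negative integer, which cannot equal `+ m`.
  nonNeg (+ _) _ = refl

∣⇒∣N∣∣∣N∣ : ∀ {α β} → α ∣ β → ℤ.∣ N α ∣ ℕ.∣ ℤ.∣ N β ∣
∣⇒∣N∣∣∣N∣ {α} (q , refl) =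
  ℕ.divides ℤ.∣ N q ∣ (trans (cong ℤ.∣_∣ (N-* q α)) (ℤ.abs-* (N q) (N α)))

∣N∣≡1⇒∣1 : ∀ {α} → ℤ.∣ N α ∣ ≡ 1 → α ∣ 1#
∣N∣≡1⇒∣1 {α} eq = conj α ,
  trans (*-comm (conj α) α)
    (trans (α*conj≡N α) (cong fromℤ (trans (N-nonNegative α) (cong +_ eq))))

≡-mod-refl : ∀ π α → α ≡ α [mod π ]
≡-mod-refl π α = 0# , trans (zeroˡ π) (sym (-‿inverseʳ α))

ω^[3+n]≡ω^n : ∀ n → ω ^ (3 ℕ.+ n) ≡ ω ^ n
ω^[3+n]≡ω^n n = trans (^-homo-* ω 3 n) (*-identityˡ (ω ^ n))

1+3n-residue : ∀ n →
  ((1 ℕ.+ n ℕ.* 3) ℕ.% 9 ≡ 1 × ω ^ n ≡ 1#) ⊎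
  ((1 ℕ.+ n ℕ.* 3) ℕ.% 9 ≡ 4 × ω ^ n ≡ ω) ⊎
  ((1 ℕ.+ n ℕ.* 3) ℕ.% 9 ≡ 7 × ω ^ n ≡ ω ^ 2)
1+3n-residue 0 = inj₁ (refl , refl)
1+3n-residue 1 = inj₂ (inj₁ (refl , refl))
1+3n-residue 2 = inj₂ (inj₂ (refl , refl))
-- Raising `n` by 3 adds 9 to `1 + 3n`, which `% 9` drops by computation; only the power of `ω` is
-- rewritten.
1+3n-residue (suc (suc (suc n))) =
  Sum.map (map₂ step) (Sum.map (map₂ step) (map₂ step)) (1+3n-residue n)
  where
  step : ∀ {α} → ω ^ n ≡ α → ω ^ (3 ℕ.+ n) ≡ α
  step = trans (ω^[3+n]≡ω^n n)

module _ {π : D} (π-prime : Prime π) (Nπ≢3 : N π ≢ + 3) where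
  open Prime π-prime using (p≉0; p∤1; split-∣)

  -- Norms are multiplicative, so `N π` would divide 3: norm 1 makes `π` a unit, and norm 3 is
  -- excluded.
  prime-∤-norm-3 : ∀ {α} → N α ≡ + 3 → π ∤ α
  prime-∤-norm-3 Nα≡3 π∣α
    with from-yes (irreducible? 3) (subst (ℤ.∣ N π ∣ ℕ.∣_) (cong ℤ.∣_∣ Nα≡3) (∣⇒∣N∣∣∣N∣ π∣α))
  ... | inj₁ ∣Nπ∣≡1 = p∤1 (∣N∣≡1⇒∣1 ∣Nπ∣≡1)
  ... | inj₂ ∣Nπ∣≡3 = Nπ≢3 (trans (N-nonNegative π) (cong +_ ∣Nπ∣≡3))

  prime-∤-ω : π ∤ ω
  prime-∤-ω π∣ω = p∤1 (∣N∣≡1⇒∣1 (ℕ.∣1⇒≡1 (∣⇒∣N∣∣∣N∣ π∣ω)))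

  -- By primality `π` would divide `1# - ω`, of norm 3, or `α`. In the latter case `N π = 3 N α`
  -- divides `N α`, which forces `N π = 0` and so `π = 0`.
  [1-ω]*α≢prime : ∀ α → (1# - ω) * α ≢ π
  [1-ω]*α≢prime α eq with split-∣ {1# - ω} {α} (1# , trans (*-identityˡ π) (sym eq))
  ... | inj₁ π∣1-ω = prime-∤-norm-3 refl π∣1-ω
  ... | inj₂ π∣α   = p≉0 (N≡0⇒≡0 π (trans (N-nonNegative π) (cong +_ ∣Nπ∣≡0)))
    where
    ∣Nπ∣≡3∣Nα∣ : ℤ.∣ N π ∣ ≡ 3 ℕ.* ℤ.∣ N α ∣
    ∣Nπ∣≡3∣Nα∣ = trans (cong (λ x → ℤ.∣ N x ∣) (sym eq))
      (trans (cong ℤ.∣_∣ (N-* (1# - ω) α)) (ℤ.abs-* (+ 3) (N α)))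

    3m∣m⇒m≡0 : ∀ m → 3 ℕ.* m ℕ.∣ m → m ≡ 0
    3m∣m⇒m≡0 zero      _    = refl
    3m∣m⇒m≡0 m@(suc _) 3m∣m =
      contradiction (ℕ.*-cancelʳ-∣ {3} {1} m (subst (3 ℕ.* m ℕ.∣_) (sym (ℕ.*-identityˡ m)) 3m∣m))
        (ℕ.>⇒∤ (s≤s (s≤s ℕ.z≤n)))

    ∣Nπ∣≡0 : ℤ.∣ N π ∣ ≡ 0
    ∣Nπ∣≡0 = trans ∣Nπ∣≡3∣Nα∣ (cong (3 ℕ.*_)
      (3m∣m⇒m≡0 _ (subst (ℕ._∣ ℤ.∣ N α ∣) ∣Nπ∣≡3∣Nα∣ (∣⇒∣N∣∣∣N∣ π∣α))))

  prime-norm≡1+3n : ∃ λ n → N π ≡ + (1 ℕ.+ n ℕ.* 3)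
  prime-norm≡1+3n = byResidue π refl
    where
    b≡[a+b]-a : ∀ a b → b ≡ (a ℤ.+ b) ℤ.- a
    b≡[a+b]-a = solve-∀

    -- The two coordinates of `(1# - ω) * ⟨ a - t , t ⟩`, which is `⟨ a , b ⟩` when `a + b = 3t`.
    const₀ : ∀ a t → 1ℤ ℤ.* (a ℤ.- t) ℤ.- ℤ.- 1ℤ ℤ.* t ≡ a
    const₀ = solve-∀
    ωcoef₀ : ∀ a t → 1ℤ ℤ.* t ℤ.+ ℤ.- 1ℤ ℤ.* (a ℤ.- t) ℤ.- ℤ.- 1ℤ ℤ.* t ≡ (0ℤ ℤ.+ t ℤ.* + 3) ℤ.- a
    ωcoef₀ = solve-∀

    norm₁ : ∀ a t → ∃ λ s → N ⟨ a , (1ℤ ℤ.+ t ℤ.* + 3) ℤ.- a ⟩ ≡ 1ℤ ℤ.+ s ℤ.* + 3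
    -- The witness comes from `N = (a + b)² - 3ab` and `(1 + 3t)² = 1 + 3(3t² + 2t)`; likewise
    -- `norm₂` uses `(2 + 3t)² = 1 + 3(3t² + 4t + 1)`.
    norm₁ a t = + 3 ℤ.* (t ℤ.* t) ℤ.+ + 2 ℤ.* t ℤ.- a ℤ.* ((1ℤ ℤ.+ t ℤ.* + 3) ℤ.- a) , eq a t
      where
      eq : ∀ a t → let b = (1ℤ ℤ.+ t ℤ.* + 3) ℤ.- a in
        a ℤ.* a ℤ.- a ℤ.* b ℤ.+ b ℤ.* b
          ≡ 1ℤ ℤ.+ (+ 3 ℤ.* (t ℤ.* t) ℤ.+ + 2 ℤ.* t ℤ.- a ℤ.* b) ℤ.* + 3
      eq = solve-∀

    norm₂ : ∀ a t → ∃ λ s → N ⟨ a , (+ 2 ℤ.+ t ℤ.* + 3) ℤ.- a ⟩ ≡ 1ℤ ℤ.+ s ℤ.* + 3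
    norm₂ a t = + 3 ℤ.* (t ℤ.* t) ℤ.+ + 4 ℤ.* t ℤ.+ 1ℤ ℤ.- a ℤ.* ((+ 2 ℤ.+ t ℤ.* + 3) ℤ.- a) , eq a t
      where
      eq : ∀ a t → let b = (+ 2 ℤ.+ t ℤ.* + 3) ℤ.- a in
        a ℤ.* a ℤ.- a ℤ.* b ℤ.+ b ℤ.* b
          ≡ 1ℤ ℤ.+ (+ 3 ℤ.* (t ℤ.* t) ℤ.+ + 4 ℤ.* t ℤ.+ 1ℤ ℤ.- a ℤ.* b) ℤ.* + 3
      eq = solve-∀

    quotient≥0 : ∀ s {m} → + m ≡ 1ℤ ℤ.+ s ℤ.* + 3 → ∃ λ n → + m ≡ + (1 ℕ.+ n ℕ.* 3)
    -- A negative `s` makes `1 + 3s` negative, which contradicts its being `+ m`.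
    quotient≥0 (+ n) eq = n , trans eq (cong (λ m → 1ℤ ℤ.+ m) (sym (ℤ.pos-* n 3)))

    toNat : ∀ α → (∃ λ s → N α ≡ 1ℤ ℤ.+ s ℤ.* + 3) → ∃ λ n → N α ≡ + (1 ℕ.+ n ℕ.* 3)
    toNat α (s , eq) = map₂ (trans (N-nonNegative α))
      (quotient≥0 s (trans (sym (N-nonNegative α)) eq))

    byResidue : ∀ α → α ≡ π → ∃ λ n → N α ≡ + (1 ℕ.+ n ℕ.* 3)
    byResidue ⟨ a , b ⟩ α≡π
      -- Abstracting remainder and quotient together frees them of `b`, so that `refl` can replace
      -- `b` by `(r + 3t) - a`.
      with (a ℤ.+ b) %ℕ 3 | (a ℤ.+ b) ℤ./ℕ 3 | ℤ.n%ℕd<d (a ℤ.+ b) 3 | ℤ.a≡a%ℕn+[a/ℕn]*n (a ℤ.+ b) 3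
    ... | r | t | r<3 | a+b≡ with trans (b≡[a+b]-a a b) (cong (ℤ._- a) a+b≡)
    byResidue ⟨ a , _ ⟩ α≡π | 0 | t | _ | _ | refl =
      contradiction (trans (cong₂ ⟨_,_⟩ (const₀ a t) (ωcoef₀ a t)) α≡π)
        ([1-ω]*α≢prime ⟨ a ℤ.- t , t ⟩)
    byResidue α@(⟨ a , _ ⟩) _ | 1 | t | _ | _ | refl = toNat α (norm₁ a t)
    byResidue α@(⟨ a , _ ⟩) _ | 2 | t | _ | _ | refl = toNat α (norm₂ a t)
    byResidue _ _ | suc (suc (suc _)) | _ | s≤s (s≤s (s≤s ())) | _ | _

  cubeRoot-unique : ∀ {α β} → α ∈ cubeRootsOfUnity → β ∈ cubeRootsOfUnity →
                    α ≡ β [mod π ] → β ≡ α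
  cubeRoot-unique (here refl)                 (here refl)                 _ = refl
  -- Here and in the other mixed cases `refl` evaluates the norm of the difference to 3.
  cubeRoot-unique (here refl)                 (there (here refl))         d = contradiction d (prime-∤-norm-3 refl)
  cubeRoot-unique (here refl)                 (there (there (here refl))) d = contradiction d (prime-∤-norm-3 refl)
  cubeRoot-unique (there (here refl))         (here refl)                 d = contradiction d (prime-∤-norm-3 refl)
  cubeRoot-unique (there (here refl))         (there (here refl))         _ = refl
  cubeRoot-unique (there (here refl))         (there (there (here refl))) d = contradiction d (prime-∤-norm-3 refl)
  cubeRoot-unique (there (there (here refl))) (here refl)                 d = contradiction d (prime-∤-norm-3 refl)
  cubeRoot-unique (there (there (here refl))) (there (here refl))         d = contradiction d (prime-∤-norm-3 refl)
  cubeRoot-unique (there (there (here refl))) (there (there (here refl))) _ = refl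

  -- The power is congruent to itself, so it is the character value as soon as it is a cube root of
  -- unity; the cases modulo 9 supply that.
  χ-ω : ω ^ cubicExponent π ∈ cubeRootsOfUnity → χ π ω ≡ ω ^ cubicExponent π
  χ-ω isRoot = χ-unique prime-∤-ω record
    { isRoot    = isRoot
    ; congruent = ≡-mod-refl π (ω ^ cubicExponent π)
    ; unique    = cubeRoot-unique isRoot
    }

theorem3p14 : (π : D) → Prime π → N π ≢ + 3 →
    (χ π ω ≡ ω ^ cubicExponent π) ×
    ((N π %ℕ 9 ≡ 1 × ω ^ cubicExponent π ≡ 1#) ⊎
    (N π %ℕ 9 ≡ 4 × ω ^ cubicExponent π ≡ ω) ⊎
    (N π %ℕ 9 ≡ 7 × ω ^ cubicExponent π ≡ ω ^ 2))
theorem3p14 π π-prime Nπ≢3 = χ-ω π-prime Nπ≢3 (isRoot {N π} {cubicExponent π} cases) , cases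
  where
  Cases : ℤ → ℕ → Set
  Cases m n = (m %ℕ 9 ≡ 1 × ω ^ n ≡ 1#) ⊎ (m %ℕ 9 ≡ 4 × ω ^ n ≡ ω) ⊎ (m %ℕ 9 ≡ 7 × ω ^ n ≡ ω ^ 2)

  cases : Cases (N π) (cubicExponent π)
  cases with n , Nπ≡ ← prime-norm≡1+3n π-prime Nπ≢3 =
    -- Once `N π` is `1 + 3n`, the exponent computes to `n * 3 / 3`; the inner `subst` turns this
    -- into `n`.
    subst (λ m → Cases m (ℤ.∣ m ℤ.- 1ℤ ∣ ℕ./ 3)) (sym Nπ≡)
      (subst (Cases (+ (1 ℕ.+ n ℕ.* 3))) (sym (ℕ.m*n/n≡m n 3)) (1+3n-residue n))

  isRoot : ∀ {m n} → Cases m n → ω ^ n ∈ cubeRootsOfUnity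
  isRoot (inj₁ (_ , eq))        = here eq
  isRoot (inj₂ (inj₁ (_ , eq))) = there (here eq)
  isRoot (inj₂ (inj₂ (_ , eq))) = there (there (here eq))
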